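{- Let $G$ be a graph and let $v$ be a vertex of $G$. Then $st_{\gamma_2}(G) \le st_{\gamma_2}(G-v)+1$.
   Context: All graphs are finite, simple and undirected. For a graph $G=(V,E)$, a subset $D \subseteq V$ is a 2-dominating set if every vertex $v \in V \setminus D$ has at least two neighbors in $D$. The 2-domination number $\gamma_2(G)$ is the minimum cardinality of a 2-dominating set of $G$. The stability of the 2-domination number, $st_{\gamma_2}(G)$, is the minimum number of vertices whose removal from $G$ (deleting the vertices and all incident edges) changes the 2-domination number, i.e. the minimum of $|S|$ over $S\subseteq V$ with $\gamma_2(G-S)\ne\gamma_2(G)$. $G-v$ is the graph obtained from $G$ by deleting $v$ and all edges incident to it. -}

module Defs where

open import Data.Empty using (⊥-elim)
open import Data.Fin.Base using (Fin)
open import Data.Fin.Subset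
open import Data.Fin.Subset.Properties
open import Data.Nat.Base using (ℕ; _≤_; _<_)
open import Data.Nat.Induction using (<-wellFounded)
open import Data.Nat.Properties
  using (_≤?_; _<?_; _≟_; ≮⇒≥; ≤-trans; ≤-reflexive; n≤0⇒n≡0)
open import Data.Product.Base using (∃; _×_; _,_)
open import Data.Vec.Base using (tabulate; _∷_; there)
open import Function.Base using (id)
open import Induction.WellFounded using (Acc; acc)
open import Relation.Binary.Definitions as Binary using ()
open import Relation.Binary.PropositionalEquality
  using (_≡_; _≢_; refl; sym; trans; subst)
open import Relation.Nullary using (¬_; yes; no; does; contradiction)
open import Relation.Nullary.Decidable using (_×-dec_; ¬?)
open import Relation.Unary using (Pred; Decidable)

-- A finite simple graph whose vertices form an arbitrary subset V of the
-- labels Fin n, so that deleting vertices keeps the names of the others.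
record Graph (n : ℕ) : Set₁ where
  field
    V       : Subset n
    Adj     : Fin n → Fin n → Set
    adj?    : Binary.Decidable Adj
    adj-sym : ∀ {u w} → Adj u w → Adj w u
    irrefl  : ∀ {u} → ¬ Adj u u
    adj⇒∈V  : ∀ {u w} → Adj u w → u ∈ V

  neighbours : Fin n → Subset n
  neighbours u = tabulate (λ w → does (adj? u w))

open Graph public

private
  variable
    n : ℕ

infixl 5 _∖_ _∖ᵥ_

_∖_ : Graph n → Subset n → Graph n
G ∖ S = record
  { V       = V G ─ S
  ; Adj     = λ u w → Adj G u w × u ∉ S × w ∉ S
  ; adj?    = λ u w → adj? G u w ×-dec ¬? (u ∈? S) ×-dec ¬? (w ∈? S)
  ; adj-sym = λ (a , u∉S , w∉S) → adj-sym G a , w∉S , u∉S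
  ; irrefl  = λ (a , _) → irrefl G a
  ; adj⇒∈V  = λ (a , u∉S , _) → x∈p∧x∉q⇒x∈p─q (adj⇒∈V G a) u∉S
  }

_∖ᵥ_ : Graph n → Fin n → Graph n
G ∖ᵥ v = G ∖ ⁅ v ⁆

record MinimumCardinality (P : Pred (Subset n) _) : Set where
  field
    value    : ℕ
    attained : ∃ λ S → P S × ∣ S ∣ ≡ value
    minimal  : ∀ S → P S → value ≤ ∣ S ∣

open MinimumCardinality public

minimumCardinality : {P : Pred (Subset n) _} → Decidable P → ∃ P → MinimumCardinality P
minimumCardinality {n} {P} P? (S₀ , p₀) = search S₀ p₀ (<-wellFounded ∣ S₀ ∣)
  where
  search : ∀ S → P S → Acc _<_ ∣ S ∣ → MinimumCardinality P
  search S p (acc rec) with anySubset? (λ T → P? T ×-dec (∣ T ∣ <? ∣ S ∣))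
  ... | yes (T , q , T<S) = search T q (rec T<S)
  ... | no  none          = record
    { value    = ∣ S ∣
    ; attained = S , p , refl
    ; minimal  = λ T q → ≮⇒≥ (λ T<S → none (T , q , T<S))
    }

TwoDominating : Graph n → Pred (Subset n) _
TwoDominating G D = D ⊆ V G × Lift (λ u → 2 ≤ ∣ neighbours G u ∩ D ∣) (V G ─ D)

twoDominating? : (G : Graph n) → Decidable (TwoDominating G)
twoDominating? G D =
  (D ⊆? V G) ×-dec Lift? (λ u → 2 ≤? ∣ neighbours G u ∩ D ∣) (V G ─ D)

x∉p─p : (p : Subset n) {x : Fin n} → x ∉ p ─ p
x∉p─p (outside ∷ p) (there x∈) = x∉p─p p x∈
x∉p─p (inside  ∷ p) (there x∈) = x∉p─p p x∈

V-twoDominating : (G : Graph n) → TwoDominating G (V G)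
V-twoDominating G = id , λ u∈ → ⊥-elim (x∉p─p (V G) u∈)

minimum2Dominating : (G : Graph n) → MinimumCardinality (TwoDominating G)
minimum2Dominating G = minimumCardinality (twoDominating? G) (V G , V-twoDominating G)

γ₂ : Graph n → ℕ
γ₂ G = value (minimum2Dominating G)

Changesγ₂ : Graph n → Pred (Subset n) _
Changesγ₂ G S = S ⊆ V G × γ₂ (G ∖ S) ≢ γ₂ G

changesγ₂? : (G : Graph n) → Decidable (Changesγ₂ G)
changesγ₂? G S = (S ⊆? V G) ×-dec ¬? (γ₂ (G ∖ S) ≟ γ₂ G)

γ₂-null : (G : Graph n) → Empty (V G) → γ₂ G ≡ 0
γ₂-null {n} G empty = n≤0⇒n≡0 (≤-trans
  (minimal (minimum2Dominating G) ⊥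
    ((λ x∈⊥ → contradiction x∈⊥ ∉⊥) , λ u∈ → ⊥-elim (empty (_ , p─q⊆p (V G) ⊥ u∈))))
  (≤-reflexive (∣⊥∣≡0 n)))

γ₂-nonnull : (G : Graph n) → Nonempty (V G) → γ₂ G ≢ 0
γ₂-nonnull G (v , v∈V) γ₂≡0
  with D , (_ , dom) , ∣D∣≡γ₂ ← attained (minimum2Dominating G)
  with v ∈? D
... | yes v∈D = contradiction
  (≤-trans (≤-reflexive (sym (∣⁅x⁆∣≡1 v)))
    (≤-trans (p⊆q⇒∣p∣≤∣q∣ (λ x∈ → subst (_∈ D) (sym (x∈⁅y⁆⇒x≡y v x∈)) v∈D))
      (≤-reflexive (trans ∣D∣≡γ₂ γ₂≡0))))
  λ ()
... | no v∉D = contradiction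
  (≤-trans (dom (x∈p∧x∉q⇒x∈p─q v∈V v∉D))
    (≤-trans (∣p∩q∣≤∣q∣ (neighbours G v) D) (≤-reflexive (trans ∣D∣≡γ₂ γ₂≡0))))
  λ ()

V-changesγ₂ : (G : Graph n) → Nonempty (V G) → Changesγ₂ G (V G)
V-changesγ₂ G nonempty = id , λ eq → γ₂-nonnull G nonempty
  (trans (sym eq) (γ₂-null (G ∖ V G) (λ (_ , x∈) → x∉p─p (V G) x∈)))

minimumChanging : (G : Graph n) → Nonempty (V G) → MinimumCardinality (Changesγ₂ G)
minimumChanging G nonempty = minimumCardinality (changesγ₂? G) (V G , V-changesγ₂ G nonempty)

-- No deletion changes γ₂ of the graph without vertices; as the minimum over
-- an empty set, its stability is taken to be 0.
st-γ₂ : Graph n → ℕ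
st-γ₂ G with nonempty? (V G)
... | yes nonempty = value (minimumChanging G nonempty)
... | no  _        = 0

{-# OPTIONS --safe #-}

-- If γ₂ (G − v) ≠ γ₂ G, then {v} alone changes γ₂. Otherwise, add v to an optimal
-- set S of G − v: (G − v) − S and G − ({v} ∪ S) have the same vertices and edges.
-- Equality of γ₂ also makes G − v nonempty, so that such an S exists.
module Submission where

open import Defs
open import Data.Empty using (⊥-elim)
open import Data.Fin.Base using (Fin)
open import Data.Fin.Subset
  using (Subset; inside; outside; _∈_; _⊆_; _∪_; _∩_; _─_; ∣_∣; ⁅_⁆; Nonempty)
open import Data.Fin.Subset.Properties
  using (nonempty?; p─q─r≡p─q∪r; x∈p∪q⁻; x∈p∪q⁺; p─q⊆p; ∣⁅x⁆∣≡1; x∈⁅y⁆⇒x≡y)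
open import Data.Nat.Base using (ℕ; suc; _≤_; _+_; z≤n; s≤s)
open import Data.Nat.Properties
  using (_≟_; ≤-trans; ≤-reflexive; ≤-antisym; +-suc; +-comm; +-monoʳ-≤; n≤1+n; m≤n+m;
         module ≤-Reasoning)
open import Data.Product.Base using (∃; _×_; _,_)
open import Data.Sum.Base using (inj₁; inj₂; [_,_]′)
open import Data.Vec.Base using ([]; _∷_)
open import Data.Vec.Properties using (tabulate-cong)
open import Function.Base using (_∘_)
open import Function.Bundles using (mk⇔)
open import Relation.Binary.PropositionalEquality
  using (_≡_; _≢_; _≗_; refl; sym; trans; cong; subst)
open import Relation.Nullary using (yes; no)
open import Relation.Nullary.Decidable using (does-⇔)

private
  variable
    n : ℕ

∣p∪q∣≤∣p∣+∣q∣ : (p q : Subset n) → ∣ p ∪ q ∣ ≤ ∣ p ∣ + ∣ q ∣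
∣p∪q∣≤∣p∣+∣q∣ []            []            = z≤n
∣p∪q∣≤∣p∣+∣q∣ (outside ∷ p) (outside ∷ q) = ∣p∪q∣≤∣p∣+∣q∣ p q
∣p∪q∣≤∣p∣+∣q∣ (outside ∷ p) (inside  ∷ q) =
  ≤-trans (s≤s (∣p∪q∣≤∣p∣+∣q∣ p q)) (≤-reflexive (sym (+-suc ∣ p ∣ ∣ q ∣)))
∣p∪q∣≤∣p∣+∣q∣ (inside  ∷ p) (outside ∷ q) = s≤s (∣p∪q∣≤∣p∣+∣q∣ p q)
∣p∪q∣≤∣p∣+∣q∣ (inside  ∷ p) (inside  ∷ q) =
  -- A common element counts once on the left and twice on the right; `n≤1+n` absorbs the surplus.
  s≤s (≤-trans (∣p∪q∣≤∣p∣+∣q∣ p q) (+-monoʳ-≤ ∣ p ∣ (n≤1+n ∣ q ∣)))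

x∈p⇒⁅x⁆⊆p : {p : Subset n} {x : Fin n} → x ∈ p → ⁅ x ⁆ ⊆ p
x∈p⇒⁅x⁆⊆p {p = p} {x} x∈p y∈⁅x⁆ = subst (_∈ p) (sym (x∈⁅y⁆⇒x≡y x y∈⁅x⁆)) x∈p

-- 2-domination reads a graph only through `V` and `neighbours`. Agreement of these two is weaker
-- than equality of the records, whose `Adj` fields may be different types.
twoDominating-resp : (G H : Graph n) → V G ≡ V H → neighbours G ≗ neighbours H →
  ∀ {D} → TwoDominating G D → TwoDominating H D
twoDominating-resp G H V≡ N≗ {D} (D⊆V , dom) =
  subst (D ⊆_) V≡ D⊆V ,
  λ {u} u∈ → subst (λ N → 2 ≤ ∣ N ∩ D ∣) (N≗ u)
    (dom (subst (λ W → u ∈ W ─ D) (sym V≡) u∈))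

-- A minimum 2-dominating set of `H` is a competitor for the minimum in `G`.
γ₂-mono : (G H : Graph n) → (∀ {D} → TwoDominating H D → TwoDominating G D) → γ₂ G ≤ γ₂ H
γ₂-mono G H H⇒G with D , domD , ∣D∣≡γ₂ ← attained (minimum2Dominating H) =
  ≤-trans (minimal (minimum2Dominating G) D (H⇒G domD)) (≤-reflexive ∣D∣≡γ₂)

γ₂-cong : (G H : Graph n) → V G ≡ V H → neighbours G ≗ neighbours H → γ₂ G ≡ γ₂ H
γ₂-cong G H V≡ N≗ = ≤-antisym
  (γ₂-mono G H (twoDominating-resp H G (sym V≡) (sym ∘ N≗)))
  (γ₂-mono H G (twoDominating-resp G H V≡ N≗))

γ₂-∖-∪ : (G : Graph n) (S T : Subset n) → γ₂ (G ∖ S ∖ T) ≡ γ₂ (G ∖ (S ∪ T))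
γ₂-∖-∪ G S T = γ₂-cong (G ∖ S ∖ T) (G ∖ (S ∪ T)) (p─q─r≡p─q∪r (V G) S T)
  -- `neighbours` tabulates only the booleans of `adj?`, so logically equivalent adjacencies give
  -- equal neighbourhoods.
  λ u → tabulate-cong λ w → does-⇔
    (mk⇔
      (λ ((a , u∉S , w∉S) , u∉T , w∉T) →
        a , [ u∉S , u∉T ]′ ∘ x∈p∪q⁻ S T , [ w∉S , w∉T ]′ ∘ x∈p∪q⁻ S T)
      (λ (a , u∉ , w∉) →
        (a , u∉ ∘ x∈p∪q⁺ ∘ inj₁ , w∉ ∘ x∈p∪q⁺ ∘ inj₁) ,
        u∉ ∘ x∈p∪q⁺ ∘ inj₂ , w∉ ∘ x∈p∪q⁺ {p = S} ∘ inj₂))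
    (adj? (G ∖ S ∖ T) u w) (adj? (G ∖ (S ∪ T)) u w)

st-γ₂-minimal : (G : Graph n) {S : Subset n} → Changesγ₂ G S → st-γ₂ G ≤ ∣ S ∣
st-γ₂-minimal G {S} changes with nonempty? (V G)
... | yes nonempty = minimal (minimumChanging G nonempty) S changes
-- Here `st-γ₂ G` is the default value 0.
... | no  _        = z≤n

st-γ₂-attained : (G : Graph n) → Nonempty (V G) → ∃ λ S → Changesγ₂ G S × ∣ S ∣ ≡ st-γ₂ G
st-γ₂-attained G nonempty with nonempty? (V G)
... | yes nonempty′ = attained (minimumChanging G nonempty′)
... | no  empty     = ⊥-elim (empty nonempty)

-- `γ₂` is 0 exactly for the graph without vertices.
γ₂≡⇒nonempty : (G H : Graph n) → γ₂ G ≡ γ₂ H → Nonempty (V H) → Nonempty (V G)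
γ₂≡⇒nonempty G H eq nonempty with nonempty? (V G)
... | yes nonempty′ = nonempty′
... | no  empty     = ⊥-elim (γ₂-nonnull H nonempty (trans (sym eq) (γ₂-null G empty)))

proposition3p1 : ∀ {n : ℕ} (G : Graph n) (v : Fin n) → v ∈ V G →
    st-γ₂ G ≤ st-γ₂ (G ∖ᵥ v) + 1
proposition3p1 G v v∈V with γ₂ (G ∖ᵥ v) ≟ γ₂ G
... | no γ₂≢ = begin
  st-γ₂ G              ≤⟨ st-γ₂-minimal G (x∈p⇒⁅x⁆⊆p v∈V , γ₂≢) ⟩
  ∣ ⁅ v ⁆ ∣            ≡⟨ ∣⁅x⁆∣≡1 v ⟩
  -- This bound holds even if `G ∖ᵥ v` has no vertices and its stability is the default 0.
  1                    ≤⟨ m≤n+m 1 (st-γ₂ (G ∖ᵥ v)) ⟩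
  st-γ₂ (G ∖ᵥ v) + 1   ∎
  where open ≤-Reasoning
-- `G` contains `v`, so `γ₂≡` forces `G ∖ᵥ v` to have a vertex; its stability is then a true
-- minimum, attained by some `S`.
... | yes γ₂≡ with S , (S⊆V─v , γ₂≢) , ∣S∣≡st ←
        st-γ₂-attained (G ∖ᵥ v) (γ₂≡⇒nonempty (G ∖ᵥ v) G γ₂≡ (v , v∈V)) = begin
  st-γ₂ G              ≤⟨ st-γ₂-minimal G (v∪S⊆V , changes) ⟩
  ∣ ⁅ v ⁆ ∪ S ∣        ≤⟨ ∣p∪q∣≤∣p∣+∣q∣ ⁅ v ⁆ S ⟩
  ∣ ⁅ v ⁆ ∣ + ∣ S ∣    ≡⟨ cong (_+ ∣ S ∣) (∣⁅x⁆∣≡1 v) ⟩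
  suc ∣ S ∣            ≡⟨ cong suc ∣S∣≡st ⟩
  suc (st-γ₂ (G ∖ᵥ v)) ≡⟨ +-comm 1 _ ⟩
  st-γ₂ (G ∖ᵥ v) + 1   ∎
  where
  open ≤-Reasoning
  v∪S⊆V : ⁅ v ⁆ ∪ S ⊆ V G
  v∪S⊆V x∈ with x∈p∪q⁻ ⁅ v ⁆ S x∈
  ... | inj₁ x∈v = x∈p⇒⁅x⁆⊆p v∈V x∈v
  ... | inj₂ x∈S = p─q⊆p (V G) ⁅ v ⁆ (S⊆V─v x∈S)
  changes : γ₂ (G ∖ (⁅ v ⁆ ∪ S)) ≢ γ₂ G
  -- If `⁅ v ⁆ ∪ S` left `γ₂ G` unchanged, then deleting `S` from `G ∖ᵥ v` would give `γ₂ G`, which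
  -- is `γ₂ (G ∖ᵥ v)`, against the choice of `S`.
  changes eq = γ₂≢ (trans (γ₂-∖-∪ G ⁅ v ⁆ S) (trans eq (sym γ₂≡)))
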